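{- Let $f(x)\in\mathbb{Z}[x]$ be a positive polynomial. Then there exists a unique least positive integer $a$ and a unique base-$x$ representation of $f(x)$ as follows: $$f(x)=b_0(x)\,1+b_1(x)\,x+b_2(x)\,x^2+\cdots+b_m(x)\,x^m,$$ with $$b_i(x)\in\{0,1,\dots,a-1\}\cup\{x-1,\dots,x-a\},\qquad b_m(x)\neq 0.$$ In particular, the unique representation of $f(b)\in\mathbb{N}$ in base $b$ for all $b\ge a$ is given by $$f(b)=[\,b_m(b)\cdots b_1(b)\,b_0(b)\,]_b.$$
   Context: $\mathbb{N}$ is the set of positive integers. A polynomial $f(x)\in\mathbb{Z}[x]$ is called positive if it has positive values for $x\ge k$ for some $k\in\mathbb{Z}$, that is, if it has a positive leading coefficient. The notation $[d_m\cdots d_1d_0]_b$ stands for the base-$b$ expansion $\sum_{i=0}^m d_i b^i$ with digits $d_i$ between $0$ and $b-1$. In a base-$x$ representation, the "coefficients" $b_i(x)$ are digits from the infinite alphabet consisting of the constant digits $0,1,2,\dots$ and the linear digits $x-1,x-2,\dots$.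
   Formalization: For f = x-2 one has a = 2 but f(2) = 0, which is not a positive integer; so at b = a the expansion is stated with f(b) possibly zero and leading zeros allowed, and f(b) > 0 with nonzero leading digit is claimed only for b > a. -}

module Defs where

open import Data.Digit using (Expansion; fromDigits)
open import Data.Fin.Base using (toℕ)
open import Data.Integer.Base as ℤ using (ℤ; +_; -[1+_]; 0ℤ; 1ℤ)
open import Data.List.Base using (List; []; _∷_)
open import Data.Nat.Base using (ℕ; zero; suc; _<_; _≤_)
open import Data.Product.Base using (∃; _×_; _,_)
open import Data.Vec.Base as Vec using (Vec; []; _∷_)
open import Data.Vec.Relation.Unary.All using (All)
open import Relation.Binary.PropositionalEquality.Core using (_≡_)
open import Relation.Nullary.Negation.Core using (¬_)

------------------------------------------------------------------------
-- ℤ[x]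

-- Coefficient lists, constant term first. Trailing zeros are allowed, so
-- equality of polynomials is _≋_ rather than _≡_.

Poly : Set
Poly = List ℤ

coeff : Poly → ℕ → ℤ
coeff []      _       = 0ℤ
coeff (c ∷ p) zero    = c
coeff (c ∷ p) (suc i) = coeff p i

infix 4 _≋_

_≋_ : Poly → Poly → Set
p ≋ q = ∀ i → coeff p i ≡ coeff q i

infixl 6 _⊕_

_⊕_ : Poly → Poly → Poly
[]      ⊕ q       = q
(c ∷ p) ⊕ []      = c ∷ p
(c ∷ p) ⊕ (d ∷ q) = (c ℤ.+ d) ∷ (p ⊕ q)

x·_ : Poly → Poly
x· p = 0ℤ ∷ p

eval : Poly → ℤ → ℤ
eval []      t = 0ℤ
eval (c ∷ p) t = c ℤ.+ t ℤ.* eval p t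

Positive : Poly → Set
Positive f = ∃ λ (k : ℤ) → ∀ (t : ℤ) → k ℤ.≤ t → 0ℤ ℤ.< eval f t

------------------------------------------------------------------------
-- Base x

-- x-[1+ j ] is the linear digit x - (1 + j), as for -[1+_] in ℤ.

data XDigit : Set where
  const   : (c : ℕ) → XDigit
  x-[1+_] : (j : ℕ) → XDigit

⟦_⟧ : XDigit → Poly
⟦ const c ⟧   = + c ∷ []
⟦ x-[1+ j ] ⟧ = -[1+ j ] ∷ 1ℤ ∷ []

-- d ∈Alphabet a means d ∈ {0, 1, …, a - 1} ∪ {x - 1, …, x - a}.

data _∈Alphabet_ : XDigit → ℕ → Set where
  const   : ∀ {c a} → c < a → const c ∈Alphabet a
  x-[1+_] : ∀ {j a} → j < a → x-[1+ j ] ∈Alphabet a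

-- (m , b₀ ∷ b₁ ∷ … ∷ bₘ ∷ []), least significant digit first.

XNumeral : Set
XNumeral = ∃ λ (m : ℕ) → Vec XDigit (suc m)

-- b₀ + b₁ x + ⋯ + bₙ₋₁ xⁿ⁻¹, by Horner's rule.

value : ∀ {n} → Vec XDigit n → Poly
value []       = []
value (d ∷ ds) = ⟦ d ⟧ ⊕ x· value ds

_Represents_ : XNumeral → Poly → Set
(m , ds) Represents f = f ≋ value ds × ¬ (⟦ Vec.last ds ⟧ ≋ [])

_UsesAlphabet_ : XNumeral → ℕ → Set
(m , ds) UsesAlphabet a = All (_∈Alphabet a) ds

Admissible : Poly → ℕ → Set
Admissible f a = 0 < a × ∃ λ β → β Represents f × β UsesAlphabet a

IsLeast : (ℕ → Set) → ℕ → Set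
IsLeast P a = P a × (∀ a′ → P a′ → a ≤ a′)

------------------------------------------------------------------------
-- Base b

_IsExpansionOf_ : ∀ {b} → Expansion b → ℤ → Set
ds IsExpansionOf n = n ≡ + fromDigits ds

digitAt : ∀ {b} → Expansion b → ℕ → ℕ
digitAt []       _       = 0
digitAt (d ∷ ds) zero    = toℕ d
digitAt (d ∷ ds) (suc i) = digitAt ds i

-- Equality of expansions up to leading zeros.

infix 4 _≈₀_

_≈₀_ : ∀ {b} → Expansion b → Expansion b → Set
ds ≈₀ es = ∀ i → digitAt ds i ≡ digitAt es i

{-# OPTIONS --safe #-}

-- The sign of the constant coefficient decides the lowest digit: c ≥ 0 is
-- the digit c, and c < 0 is the linear digit x - |c|, which borrows 1 from the
-- next coefficient. So representations are unique, and for f ≠ 0 the only way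
-- for the algorithm to fail is to end with an unpaid borrow; then f is
-- eventually negative. The least a is therefore one more than the largest
-- index of a digit of f, and for b ≥ a substituting x = b turns every digit
-- into a base-b digit.

module Submission where

open import Defs
open import Data.Digit using (Expansion; fromDigits)
open import Data.Empty using (⊥-elim)
open import Data.Fin.Base using (Fin; toℕ; fromℕ<)
open import Data.Fin.Properties using (toℕ<n; toℕ-fromℕ<)
open import Data.Integer.Base as ℤ using (ℤ; +_; -[1+_]; 0ℤ; 1ℤ; -1ℤ)
import Data.Integer.Properties as ℤ
open import Algebra.Properties.AbelianGroup ℤ.+-0-abelianGroup using () renaming (∙-cancelˡ to ℤ+-cancelˡ)
open import Data.Integer.Tactic.RingSolver using (solve-∀)
open import Data.List.Base using ([]; _∷_)
open import Data.Nat.Base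
  using (ℕ; zero; suc; _+_; _*_; _∸_; _⊔_; _≤_; _<_; z≤n; s≤s)
open import Data.Nat.DivMod using (_%_; [m+kn]%n≡m%n; m<n⇒m%n≡m)
import Data.Nat.Properties as ℕ
open import Data.Product using (Σ; ∃; ∃!; _×_; _,_)
open import Data.Sum.Base using (_⊎_; inj₁; inj₂)
open import Data.Vec.Base using (Vec; []; _∷_; lookup; last; toList)
open import Data.Vec.Relation.Binary.Pointwise.Inductive as Pointwise
  using (Pointwise; []; _∷_)
open import Data.Vec.Relation.Unary.All using (All; []; _∷_)
open import Function.Base using (case_of_)
open import Relation.Binary.PropositionalEquality
  using (refl; sym; trans; cong; cong₂; subst; module ≡-Reasoning)
open import Relation.Binary.PropositionalEquality.Core using (_≡_; _≢_)
open import Relation.Nullary.Negation using (¬_)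

-- Arithmetic and evaluation of polynomials up to trailing zeros.

coeff-⊕ : ∀ p q i → coeff (p ⊕ q) i ≡ coeff p i ℤ.+ coeff q i
coeff-⊕ []      q       i       = sym (ℤ.+-identityˡ _)
coeff-⊕ (c ∷ p) []      i       = sym (ℤ.+-identityʳ _)
coeff-⊕ (c ∷ p) (d ∷ q) zero    = refl
coeff-⊕ (c ∷ p) (d ∷ q) (suc i) = coeff-⊕ p q i

x·-cong : ∀ p q → p ≋ q → x· p ≋ x· q
x·-cong p q p≋q zero    = refl
x·-cong p q p≋q (suc i) = p≋q i

⊕-congˡ : ∀ p q r → q ≋ r → p ⊕ q ≋ p ⊕ r
⊕-congˡ p q r q≋r i = begin
  coeff (p ⊕ q) i              ≡⟨ coeff-⊕ p q i ⟩
  coeff p i ℤ.+ coeff q i      ≡⟨ cong (λ u → coeff p i ℤ.+ u) (q≋r i) ⟩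
  coeff p i ℤ.+ coeff r i      ≡⟨ coeff-⊕ p r i ⟨
  coeff (p ⊕ r) i              ∎
  where open ≡-Reasoning

⊕-cancelˡ : ∀ p q r → p ⊕ q ≋ p ⊕ r → q ≋ r
⊕-cancelˡ p q r eq i = ℤ+-cancelˡ (coeff p i) _ _ (begin
  coeff p i ℤ.+ coeff q i      ≡⟨ coeff-⊕ p q i ⟨
  coeff (p ⊕ q) i              ≡⟨ eq i ⟩
  coeff (p ⊕ r) i              ≡⟨ coeff-⊕ p r i ⟩
  coeff p i ℤ.+ coeff r i      ∎)
  where open ≡-Reasoning

eval-≋[] : ∀ p t → p ≋ [] → eval p t ≡ 0ℤ
eval-≋[] []      t p≋[] = refl
eval-≋[] (c ∷ p) t p≋[] = begin
  c ℤ.+ t ℤ.* eval p t  ≡⟨ cong₂ (λ u v → u ℤ.+ t ℤ.* v) (p≋[] 0) (eval-≋[] p t (λ i → p≋[] (suc i))) ⟩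
  0ℤ ℤ.+ t ℤ.* 0ℤ       ≡⟨ cong (λ u → 0ℤ ℤ.+ u) (ℤ.*-zeroʳ t) ⟩
  0ℤ                    ∎
  where open ≡-Reasoning

eval-cong : ∀ p q t → p ≋ q → eval p t ≡ eval q t
eval-cong []      q       t p≋q = sym (eval-≋[] q t (λ i → sym (p≋q i)))
eval-cong (c ∷ p) []      t p≋q = eval-≋[] (c ∷ p) t p≋q
eval-cong (c ∷ p) (d ∷ q) t p≋q =
  cong₂ (λ u v → u ℤ.+ t ℤ.* v) (p≋q 0) (eval-cong p q t (λ i → p≋q (suc i)))

eval-⊕ : ∀ p q t → eval (p ⊕ q) t ≡ eval p t ℤ.+ eval q t
eval-⊕ []      q       t = sym (ℤ.+-identityˡ _)
eval-⊕ (c ∷ p) []      t = sym (ℤ.+-identityʳ _)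
eval-⊕ (c ∷ p) (d ∷ q) t rewrite eval-⊕ p q t = interchange c d t (eval p t) (eval q t)
  where
  interchange : ∀ c d t u v →
    c ℤ.+ d ℤ.+ t ℤ.* (u ℤ.+ v) ≡ c ℤ.+ t ℤ.* u ℤ.+ (d ℤ.+ t ℤ.* v)
  interchange = solve-∀

eval-⊕-x· : ∀ p q t → eval (p ⊕ x· q) t ≡ eval p t ℤ.+ t ℤ.* eval q t
eval-⊕-x· p q t = trans (eval-⊕ p (x· q) t) (cong (λ u → eval p t ℤ.+ u) (ℤ.+-identityˡ (t ℤ.* eval q t)))

-- Digits and their values at an integer base.

index : XDigit → ℕ
index (const c)   = c
index (x-[1+ j ]) = j

-- The truncated subtraction is exact once `index d < b`, the bound under which `eval-digit` uses
-- it.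
digitValue : XDigit → ℕ → ℕ
digitValue (const c)   b = c
digitValue (x-[1+ j ]) b = b ∸ suc j

eval-digit : ∀ d {b} → index d < b → eval ⟦ d ⟧ (+ b) ≡ + digitValue d b
eval-digit (const c)   {b} c<b = trans (cong (λ u → + c ℤ.+ u) (ℤ.*-zeroʳ (+ b))) (ℤ.+-identityʳ (+ c))
eval-digit (x-[1+ j ]) {b} j<b = trans (linear -[1+ j ] (+ b)) (ℤ.⊖-≥ j<b)
  where
  linear : ∀ c t → c ℤ.+ t ℤ.* (1ℤ ℤ.+ t ℤ.* 0ℤ) ≡ t ℤ.+ c
  linear = solve-∀

digitValue< : ∀ d {b} → index d < b → digitValue d b < b
digitValue< (const c)           c<b     = c<b
digitValue< (x-[1+ j ]) {suc b} (s≤s _) = s≤s (ℕ.m∸n≤m b j)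

-- A base one larger than for `digitValue<` is demanded because x - (1 + j) vanishes at x = 1 + j.
-- For example, f = x - 1 has least a = 1, and f(1) = 0.
digitValue≢0 : ∀ d {b} → ¬ (⟦ d ⟧ ≋ []) → suc (index d) < b → digitValue d b ≢ 0
digitValue≢0 (const zero)    d≉0 _     _  = d≉0 λ { zero → refl ; (suc i) → refl }
digitValue≢0 (const (suc c)) d≉0 _     ()
digitValue≢0 (x-[1+ j ])     d≉0 1+j<b eq = ℕ.<⇒≱ 1+j<b (ℕ.m∸n≡0⇒m≤n eq)

-- Uniqueness of the base-x representation.

digit : ℤ → XDigit
digit (+ n)    = const n
digit -[1+ j ] = x-[1+ j ]

-- The part `x· p` adds nothing to the constant term, and distinct digits have distinct constant
-- terms: nonnegative for constant digits, negative for linear ones.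
digit-coeff₀ : ∀ d p → digit (coeff (⟦ d ⟧ ⊕ x· p) 0) ≡ d
digit-coeff₀ (const c)   p rewrite ℕ.+-identityʳ c = refl
digit-coeff₀ (x-[1+ j ]) p = refl

value-injective-head : ∀ {m n} d e (ds : Vec XDigit m) (es : Vec XDigit n) →
  value (d ∷ ds) ≋ value (e ∷ es) → d ≡ e
value-injective-head d e ds es eq = begin
  d                                         ≡⟨ digit-coeff₀ d (value ds) ⟨
  digit (coeff (⟦ d ⟧ ⊕ x· value ds) 0)     ≡⟨ cong digit (eq 0) ⟩
  digit (coeff (⟦ e ⟧ ⊕ x· value es) 0)     ≡⟨ digit-coeff₀ e (value es) ⟩
  e                                         ∎
  where open ≡-Reasoning

value-injective-tail : ∀ {m n} d (ds : Vec XDigit m) (es : Vec XDigit n) →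
  value (d ∷ ds) ≋ value (d ∷ es) → value ds ≋ value es
value-injective-tail d ds es eq i = ⊕-cancelˡ ⟦ d ⟧ (x· value ds) (x· value es) eq (suc i)

value≋[]⇒last≋[] : ∀ {m} (ds : Vec XDigit (suc m)) → value ds ≋ [] → ⟦ last ds ⟧ ≋ []
value≋[]⇒last≋[] (d ∷ ds) ds≋0
  -- The one-digit numeral `const 0` also has value zero, so comparing lowest digits forces `d` to
  -- be `const 0`.
  with refl ← value-injective-head d (const 0) ds [] (λ { zero → ds≋0 0 ; (suc i) → ds≋0 (suc i) })
  with ds
... | []     = λ { zero → refl ; (suc i) → refl }
... | e ∷ es = value≋[]⇒last≋[] (e ∷ es) λ i → ds≋0 (suc i)

-- Equal lowest digits are stripped from both numerals. If one runs out first, what remains of the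
-- other has value zero, so its leading digit would be zero. Lengths are not known to agree
-- beforehand, hence the equality in `XNumeral`.
represents-unique : ∀ {m n} (ds : Vec XDigit (suc m)) (es : Vec XDigit (suc n)) →
  ¬ (⟦ last ds ⟧ ≋ []) → ¬ (⟦ last es ⟧ ≋ []) → value ds ≋ value es →
  _≡_ {A = XNumeral} (m , ds) (n , es)
represents-unique (d ∷ ds) (e ∷ es) ds≉0 es≉0 eq with refl ← value-injective-head d e ds es eq
  with ds | es | value-injective-tail d ds es eq
... | []          | []          | _   = refl
... | []          | es⁺@(_ ∷ _) | eq′ = ⊥-elim (es≉0 (value≋[]⇒last≋[] es⁺ (λ i → sym (eq′ i))))
... | ds⁺@(_ ∷ _) | []          | eq′ = ⊥-elim (ds≉0 (value≋[]⇒last≋[] ds⁺ eq′))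
... | ds⁺@(_ ∷ _) | es⁺@(_ ∷ _) | eq′ =
  cong (λ { (k , gs) → suc k , d ∷ gs }) (represents-unique ds⁺ es⁺ ds≉0 es≉0 eq′)

Represents-unique : ∀ f β γ → β Represents f → γ Represents f → β ≡ γ
Represents-unique f (_ , β) (_ , γ) (f≋β , β≉0) (f≋γ , γ≉0) =
  represents-unique β γ β≉0 γ≉0 λ i → trans (sym (f≋β i)) (f≋γ i)

-- Existence of the base-x representation.

EventuallyNegative : Poly → Set
EventuallyNegative f = ∃ λ k → ∀ n → k ≤ n → eval f (+ n) ℤ.< 0ℤ

Positive⇒¬EventuallyNegative : ∀ f → Positive f → ¬ EventuallyNegative f
Positive⇒¬EventuallyNegative f (k , pos) (l , neg) =
  ℤ.<-asym (pos (+ n) k≤n) (neg n (ℕ.m≤n⊔m ℤ.∣ k ∣ l))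
  where
  -- A common point beyond both thresholds; the absolute value turns the integer threshold `k` into
  -- a natural number.
  n = ℤ.∣ k ∣ ⊔ l
  k≤n : k ℤ.≤ + n
  k≤n = ℤ.≤-trans (i≤+∣i∣ k) (ℤ.+≤+ (ℕ.m≤m⊔n ℤ.∣ k ∣ l))
    where
    i≤+∣i∣ : ∀ i → i ℤ.≤ + ℤ.∣ i ∣
    i≤+∣i∣ (+ n)    = ℤ.≤-refl
    i≤+∣i∣ -[1+ n ] = ℤ.-≤+

Positive⇒≉[] : ∀ f → Positive f → ¬ (f ≋ [])
Positive⇒≉[] f (k , pos) f≋[] =
  ℤ.<-irrefl (sym (eval-≋[] f k f≋[])) (pos k ℤ.≤-refl)

-- A digit is smaller than the base b, so it cannot outweigh b times a
-- negative integer.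
⊕-x·-negative : ∀ d p → EventuallyNegative p → EventuallyNegative (⟦ d ⟧ ⊕ x· p)
⊕-x·-negative d p (k , neg) = suc (index d) ⊔ k , λ n k≤n →
  let d<n = ℕ.m⊔n≤o⇒m≤o (suc (index d)) k k≤n
      p<0 = neg n (ℕ.m⊔n≤o⇒n≤o (suc (index d)) k k≤n)
      open ℤ.≤-Reasoning
  in begin-strict
  eval (⟦ d ⟧ ⊕ x· p) (+ n)                 ≡⟨ eval-⊕-x· ⟦ d ⟧ p (+ n) ⟩
  eval ⟦ d ⟧ (+ n) ℤ.+ + n ℤ.* eval p (+ n) ≡⟨ cong (ℤ._+ + n ℤ.* eval p (+ n)) (eval-digit d d<n) ⟩
  + digitValue d n ℤ.+ + n ℤ.* eval p (+ n) <⟨ ℤ.+-monoˡ-< (+ n ℤ.* eval p (+ n)) (ℤ.+<+ (digitValue< d d<n)) ⟩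
  + n ℤ.+ + n ℤ.* eval p (+ n)              ≤⟨ ℤ.+-monoʳ-≤ (+ n) (ℤ.*-monoˡ-≤-nonNeg (+ n) (ℤ.i<j⇒i≤pred[j] p<0)) ⟩
  + n ℤ.+ + n ℤ.* -1ℤ                       ≡⟨ cancel (+ n) ⟩
  0ℤ                                        ∎
  where
  cancel : ∀ t → t ℤ.+ t ℤ.* -1ℤ ≡ 0ℤ
  cancel = solve-∀

EventuallyNegative-resp : ∀ p q → p ≋ q → EventuallyNegative q → EventuallyNegative p
EventuallyNegative-resp p q p≋q (k , neg) =
  k , λ n k≤n → subst (ℤ._< 0ℤ) (sym (eval-cong p q (+ n) p≋q)) (neg n k≤n)

-- The cases mirror the leading coefficient: zero, positive, negative. All three are kept because
-- the recursion runs through quotients, and already the quotient of a positive polynomial may be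
-- zero.
Trichotomy : Poly → Set
Trichotomy f = f ≋ [] ⊎ ∃ (_Represents f) ⊎ EventuallyNegative f

-- Each case for the quotient `p` settles `f`: a zero quotient leaves the digit `d` alone, a
-- representation is extended by `d` at the low end, and negativity persists.
trichotomy-digit : ∀ {f p} d → f ≋ ⟦ d ⟧ ⊕ x· p → Trichotomy p → Trichotomy f
trichotomy-digit {f} {p} d f≋ (inj₁ p≋0) = single d λ i → trans (f≋ i) (⊕-congˡ ⟦ d ⟧ (x· p) (x· []) (x·-cong p [] p≋0) i)
  where
  single : ∀ d → f ≋ ⟦ d ⟧ ⊕ x· [] → Trichotomy f
  -- The digit 0 alone is no representation, since a leading digit must be nonzero; here `f` itself
  -- is zero.
  single (const zero)    f≋d =
    inj₁ λ { zero → f≋d 0 ; (suc i) → f≋d (suc i) }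
  single (const (suc c)) f≋d =
    inj₂ (inj₁ ((0 , const (suc c) ∷ []) , f≋d , λ eq → case eq 0 of λ ()))
  single (x-[1+ j ])     f≋d =
    inj₂ (inj₁ ((0 , x-[1+ j ] ∷ []) , f≋d , λ eq → case eq 0 of λ ()))
trichotomy-digit {p = p} d f≋ (inj₂ (inj₁ ((m , e ∷ es) , p≋es , es≉0))) =
  inj₂ (inj₁ ((suc m , d ∷ e ∷ es) , (λ i → trans (f≋ i) (⊕-congˡ ⟦ d ⟧ (x· p) (x· value (e ∷ es)) (x·-cong p (value (e ∷ es)) p≋es) i)) , es≉0))
trichotomy-digit {f} {p} d f≋ (inj₂ (inj₂ p<0)) =
  inj₂ (inj₂ (EventuallyNegative-resp f (⟦ d ⟧ ⊕ x· p) f≋ (⊕-x·-negative d p p<0)))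

-- A negative `c` followed by `d` is rewritten by c + d x = (x + c) + (d - 1) x. The head is a
-- separate argument so that the borrow can change it while the recursion stays structural in `p`.
trichotomy : ∀ c p → Trichotomy (c ∷ p)
trichotomy (+ n)    []      =
  trichotomy-digit {p = []} (const n) (λ { zero → sym (ℤ.+-identityʳ (+ n)) ; (suc i) → refl }) (inj₁ λ _ → refl)
-- No coefficient is left to borrow from: the polynomial is a negative constant, so the threshold 0
-- suffices.
trichotomy -[1+ j ] []      =
  inj₂ (inj₂ (0 , λ n _ → subst (λ u → -[1+ j ] ℤ.+ u ℤ.< 0ℤ) (sym (ℤ.*-zeroʳ (+ n))) ℤ.-<+))
trichotomy (+ n)    (d ∷ p) =
  trichotomy-digit (const n) (λ { zero → sym (ℤ.+-identityʳ (+ n)) ; (suc i) → refl }) (trichotomy d p)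
trichotomy -[1+ j ] (d ∷ p) =
  trichotomy-digit (x-[1+ j ])
    (λ { zero → refl ; (suc zero) → borrow d ; (suc (suc i)) → refl })
    (trichotomy (d ℤ.+ -1ℤ) p)
  where
  borrow : ∀ d → d ≡ 1ℤ ℤ.+ (d ℤ.+ -1ℤ)
  borrow = solve-∀

represents-exists : ∀ f → Positive f → ∃ (_Represents f)
represents-exists []      f>0 = ⊥-elim (Positive⇒≉[] [] f>0 λ _ → refl)
represents-exists (c ∷ p) f>0 with trichotomy c p
... | inj₁ f≋0        = ⊥-elim (Positive⇒≉[] (c ∷ p) f>0 f≋0)
... | inj₂ (inj₁ β)   = β
... | inj₂ (inj₂ f<0) = ⊥-elim (Positive⇒¬EventuallyNegative (c ∷ p) f>0 f<0)

-- The least alphabet.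

alphabetSize : ∀ {n} → Vec XDigit n → ℕ
alphabetSize []       = 0
alphabetSize (d ∷ ds) = suc (index d) ⊔ alphabetSize ds

∈Alphabet⇒index< : ∀ {d a} → d ∈Alphabet a → index d < a
∈Alphabet⇒index< (const c<a)   = c<a
∈Alphabet⇒index< (x-[1+ j<a ]) = j<a

index<⇒∈Alphabet : ∀ d {a} → index d < a → d ∈Alphabet a
index<⇒∈Alphabet (const c)   c<a = const c<a
index<⇒∈Alphabet (x-[1+ j ]) j<a = x-[1+ j<a ]

alphabetSize≤⇒All : ∀ {n} (ds : Vec XDigit n) {a} → alphabetSize ds ≤ a → All (_∈Alphabet a) ds
alphabetSize≤⇒All []       _  = []
alphabetSize≤⇒All (d ∷ ds) le =
  index<⇒∈Alphabet d (ℕ.m⊔n≤o⇒m≤o (suc (index d)) (alphabetSize ds) le) ∷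
  alphabetSize≤⇒All ds (ℕ.m⊔n≤o⇒n≤o (suc (index d)) (alphabetSize ds) le)

All⇒alphabetSize≤ : ∀ {n} {ds : Vec XDigit n} {a} → All (_∈Alphabet a) ds → alphabetSize ds ≤ a
All⇒alphabetSize≤ []         = z≤n
All⇒alphabetSize≤ (px ∷ pxs) = ℕ.⊔-lub (∈Alphabet⇒index< px) (All⇒alphabetSize≤ pxs)

-- Any competing alphabet comes with a representation of `f`, which by uniqueness is `β`; so it must
-- contain all digits of `β`.
least-admissible : ∀ f {m} (β : Vec XDigit (suc m)) → (m , β) Represents f →
  IsLeast (Admissible f) (alphabetSize β)
least-admissible f {m} β@(d ∷ ds) repr =
  -- Positivity of the size holds because a numeral has at least one digit, which contributes at
  -- least 1 to the maximum.
  (ℕ.≤-trans (s≤s z≤n) (ℕ.m≤m⊔n (suc (index d)) (alphabetSize ds)) ,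
    (m , β) , repr , alphabetSize≤⇒All β ℕ.≤-refl) ,
  λ { a (_ , γ , γ-repr , uses) →
      All⇒alphabetSize≤ (subst (_UsesAlphabet a) (Represents-unique f γ (m , β) γ-repr repr) uses) }

IsLeast-unique : ∀ {P a a′} → IsLeast P a → IsLeast P a′ → a ≡ a′
IsLeast-unique (Pa , a-min) (Pa′ , a′-min) = ℕ.≤-antisym (a-min _ Pa′) (a′-min _ Pa)

-- Uniqueness of the base-b expansion.

quotRem-unique : ∀ {b r r′} q q′ → r < b → r′ < b → r + q * b ≡ r′ + q′ * b → r ≡ r′ × q ≡ q′
quotRem-unique {suc b} {r} {r′} q q′ r<b r′<b eq = r≡r′ , q≡q′
  where
  open ≡-Reasoning
  r≡r′ : r ≡ r′
  r≡r′ = begin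
    r                          ≡⟨ m<n⇒m%n≡m r<b ⟨
    r % suc b                  ≡⟨ [m+kn]%n≡m%n r q (suc b) ⟨
    (r + q * suc b) % suc b    ≡⟨ cong (_% suc b) eq ⟩
    (r′ + q′ * suc b) % suc b  ≡⟨ [m+kn]%n≡m%n r′ q′ (suc b) ⟩
    r′ % suc b                 ≡⟨ m<n⇒m%n≡m r′<b ⟩
    r′                         ∎
  q≡q′ : q ≡ q′
  q≡q′ = ℕ.*-cancelʳ-≡ q q′ (suc b)
    (ℕ.+-cancelˡ-≡ r _ _ (trans eq (cong (_+ q′ * suc b) (sym r≡r′))))

fromDigits≡0⇒≈₀[] : ∀ {b} (ds : Expansion b) → fromDigits ds ≡ 0 → ds ≈₀ []
fromDigits≡0⇒≈₀[] []               _  i       = refl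
fromDigits≡0⇒≈₀[] (d ∷ ds)         eq zero    = ℕ.m+n≡0⇒m≡0 (toℕ d) eq
-- The digit `d` in `Fin b` rules out base 0, so the factor `suc b` can be cancelled from the
-- vanishing product.
fromDigits≡0⇒≈₀[] {suc b} (d ∷ ds) eq (suc i) =
  fromDigits≡0⇒≈₀[] ds (ℕ.m*n≡0⇒m≡0 _ (suc b) (ℕ.m+n≡0⇒n≡0 (toℕ d) eq)) i

-- The lowest digit is the remainder modulo `b` and the rest the quotient. If one expansion ends
-- early, the other has only zeros left.
fromDigits-injective : ∀ {b} (ds es : Expansion b) → fromDigits ds ≡ fromDigits es → ds ≈₀ es
fromDigits-injective []       es       eq i = sym (fromDigits≡0⇒≈₀[] es (sym eq) i)
fromDigits-injective (d ∷ ds) []       eq i = fromDigits≡0⇒≈₀[] (d ∷ ds) eq i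
fromDigits-injective (d ∷ ds) (e ∷ es) eq i
  with d≡e , eq′ ← quotRem-unique (fromDigits ds) (fromDigits es) (toℕ<n d) (toℕ<n e) eq
  with i
... | zero  = d≡e
... | suc j = fromDigits-injective ds es eq′ j

-- By contraposition: value zero would make every digit zero, the leading one included.
fromDigits>0 : ∀ {b m} (ds : Vec (Fin b) (suc m)) → toℕ (last ds) ≢ 0 → 0 < fromDigits (toList ds)
fromDigits>0 ds last≢0 = ℕ.n≢0⇒n>0 λ eq → last≢0 (last≡0 ds (fromDigits≡0⇒≈₀[] (toList ds) eq))
  where
  last≡0 : ∀ {b m} (ds : Vec (Fin b) (suc m)) → toList ds ≈₀ [] → toℕ (last ds) ≡ 0
  last≡0 (d ∷ [])     ds≈0 = ds≈0 0
  last≡0 (d ∷ e ∷ ds) ds≈0 = last≡0 (e ∷ ds) λ i → ds≈0 (suc i)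

-- Substituting x = b.

_HasValue_ : ∀ {b} → XDigit → Fin b → Set
_HasValue_ {b} d e = eval ⟦ d ⟧ (+ b) ≡ + toℕ e

-- With a ≤ b every digit of the alphabet has index below `b`, so its value at `b` lies between 0
-- and b - 1.
digits-exist : ∀ {a b n} {ds : Vec XDigit n} → a ≤ b → All (_∈Alphabet a) ds →
  ∃ λ (es : Vec (Fin b) n) → Pointwise _HasValue_ ds es
digits-exist a≤b [] = [] , []
digits-exist {ds = d ∷ _} a≤b (d∈a ∷ ds∈a) with es , vs ← digits-exist a≤b ds∈a =
  fromℕ< (digitValue< d d<b) ∷ es ,
  trans (eval-digit d d<b) (cong +_ (sym (toℕ-fromℕ< (digitValue< d d<b)))) ∷ vs
  where d<b = ℕ.<-≤-trans (∈Alphabet⇒index< d∈a) a≤b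

eval-value : ∀ {b n} {ds : Vec XDigit n} {es : Vec (Fin b) n} → Pointwise _HasValue_ ds es →
  eval (value ds) (+ b) ≡ + fromDigits (toList es)
eval-value []                                           = refl
eval-value {b} {ds = d ∷ ds} {es = e ∷ es} (v ∷ vs) = begin
  eval (⟦ d ⟧ ⊕ x· value ds) (+ b)                   ≡⟨ eval-⊕-x· ⟦ d ⟧ (value ds) (+ b) ⟩
  eval ⟦ d ⟧ (+ b) ℤ.+ + b ℤ.* eval (value ds) (+ b) ≡⟨ cong₂ (λ u w → u ℤ.+ + b ℤ.* w) v (eval-value vs) ⟩
  -- `eval` multiplies by the base on the left, `fromDigits` on the right.
  + toℕ e ℤ.+ + b ℤ.* + n                            ≡⟨ cong (λ u → + toℕ e ℤ.+ u) (ℤ.*-comm (+ b) (+ n)) ⟩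
  + toℕ e ℤ.+ + n ℤ.* + b                            ≡⟨ cong (λ u → + toℕ e ℤ.+ u) (ℤ.pos-* n b) ⟨
  + (toℕ e + n * b)                                  ∎
  where
  open ≡-Reasoning
  n = fromDigits (toList es)

last-Pointwise : ∀ {b m} {ds : Vec XDigit (suc m)} {es : Vec (Fin b) (suc m)} →
  Pointwise _HasValue_ ds es → last ds HasValue last es
last-Pointwise (v ∷ [])     = v
last-Pointwise (_ ∷ v ∷ vs) = last-Pointwise (v ∷ vs)

last-All : ∀ {m} {P : XDigit → Set} {ds : Vec XDigit (suc m)} → All P ds → P (last ds)
last-All (px ∷ [])       = px
last-All (_ ∷ px ∷ pxs) = last-All (px ∷ pxs)

theorem3 : (f : Poly) → Positive f →
    Σ (∃! _≡_ (IsLeast (Admissible f))) λ (a , _) →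
    Σ (∃! _≡_ (_Represents f)) λ ((m , β) , _) →
    (m , β) UsesAlphabet a ×
    (∀ (b : ℕ) → a ≤ b →
    ∃ λ (ds : Vec (Fin b) (suc m)) →
    (∀ i → eval ⟦ lookup β i ⟧ (+ b) ≡ + toℕ (lookup ds i)) ×
    toList ds IsExpansionOf eval f (+ b) ×
    (∀ (es : Expansion b) → es IsExpansionOf eval f (+ b) → es ≈₀ toList ds) ×
    (a < b → 0ℤ ℤ.< eval f (+ b) × toℕ (last ds) ≢ 0))
theorem3 f f>0 with (m , β) , repr@(f≋β , β≉0) ← represents-exists f f>0 =
  (a , a-least , IsLeast-unique a-least) ,
  ((m , β) , repr , λ {γ} → Represents-unique f (m , β) γ repr) ,
  β∈a , base
  where
  a = alphabetSize β
  a-least = least-admissible f β repr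
  β∈a = alphabetSize≤⇒All β ℕ.≤-refl
  base : ∀ b → a ≤ b → _
  base b a≤b with ds , vs ← digits-exist a≤b β∈a =
    ds , Pointwise.lookup vs , expansion , unique , λ a<b →
      subst (0ℤ ℤ.<_) (sym expansion) (ℤ.+<+ (fromDigits>0 ds (last≢0 a<b))) , last≢0 a<b
    where
    expansion : toList ds IsExpansionOf eval f (+ b)
    expansion = trans (eval-cong f (value β) (+ b) f≋β) (eval-value vs)
    unique : ∀ es → es IsExpansionOf eval f (+ b) → es ≈₀ toList ds
    unique es es-exp = fromDigits-injective es (toList ds) (ℤ.+-injective (trans (sym es-exp) expansion))
    last≢0 : a < b → toℕ (last ds) ≢ 0
    -- The leading index is below `a`, so a < b supplies the extra unit of room that keeps a leading
    -- digit such as x - a from vanishing at `b`.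
    last≢0 a<b eq = digitValue≢0 (last β) β≉0 (ℕ.≤-<-trans index<a a<b)
      (trans (ℤ.+-injective (trans (sym (eval-digit (last β) (ℕ.<-≤-trans index<a a≤b))) (last-Pointwise vs))) eq)
      where
      index<a : index (last β) < a
      index<a = ∈Alphabet⇒index< (last-All β∈a)
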